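{- Let $m,n$ be positive integers and let $\mathbf{h}=(h_1,\ldots,h_m)$ and $\mathbf{k}=(k_1,\ldots,k_n)$ be sequences of nonnegative integers. If there exists a convex array $A\in\Phi(m,n;\mathbf{h},\mathbf{k})$, then there exists a $\mathrm{NASM}(m,n;\mathbf{h},\mathbf{k})$.
   Context: The weight of a row (or column) of an integer matrix is the number of its nonzero entries. $\Phi(m,n)$ is the set of all $m\times n$ arrays with entries in $\{0,1\}$ (binary arrays), and $\Psi(m,n)$ is the set of all $m\times n$ arrays with entries in $\{0,1,-1\}$. $\Phi(m,n;\mathbf{h},\mathbf{k})$ (respectively $\Psi(m,n;\mathbf{h},\mathbf{k})$) is the subset of those arrays in which row $i$ has weight $h_i$ for every $i$ and column $j$ has weight $k_j$ for every $j$. A binary array is convex if the ones are consecutive in each row and in each column (no zero lies between two ones in a row or column). An array $A\in\Psi(m,n)$ is a near alternating sign matrix (NASM) if in each row and in each column the nonzero entries alternate in sign (i.e. any two consecutive nonzero entries of a row or column, ignoring zeros, have opposite signs). A $\mathrm{NASM}(m,n;\mathbf{h},\mathbf{k})$ is a NASM belonging to $\Psi(m,n;\mathbf{h},\mathbf{k})$. -}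

module Defs where

open import Data.Fin using (_<_)
open import Data.Integer using (ℤ; 0ℤ; 1ℤ; -1ℤ; sign; _≟_)
open import Data.Nat using (ℕ)
open import Data.Product using (_×_)
open import Data.Sign using (opposite)
open import Data.Sum using (_⊎_)
open import Data.Vec using (count)
open import Data.Vec.Functional using (Vector; toVec; transpose)
open import Relation.Binary.PropositionalEquality using (_≡_; _≢_)
open import Relation.Nullary using (¬?)

-- A i j is the entry of A in row i and column j, so that column j of A is
-- transpose A j.
Array : ℕ → ℕ → Set
Array m n = Vector (Vector ℤ n) m

weight : ∀ {n} → Vector ℤ n → ℕ
weight v = count (λ x → ¬? (x ≟ 0ℤ)) (toVec v)

HasWeights : ∀ {m n} → Vector ℕ m → Vector ℕ n → Array m n → Set
HasWeights h k A =
  (∀ i → weight (A i) ≡ h i) × (∀ j → weight (transpose A j) ≡ k j)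

IsBinary : ∀ {m n} → Array m n → Set
IsBinary A = ∀ i j → A i j ≡ 0ℤ ⊎ A i j ≡ 1ℤ

IsTernary : ∀ {m n} → Array m n → Set
IsTernary A = ∀ i j → A i j ≡ 0ℤ ⊎ A i j ≡ 1ℤ ⊎ A i j ≡ -1ℤ

-- Membership in Φ(m,n;h,k) and Ψ(m,n;h,k).
Φ : ∀ m n → Vector ℕ m → Vector ℕ n → Array m n → Set
Φ m n h k A = IsBinary A × HasWeights h k A

Ψ : ∀ m n → Vector ℕ m → Vector ℕ n → Array m n → Set
Ψ m n h k A = IsTernary A × HasWeights h k A

ConsecutiveOnes : ∀ {n} → Vector ℤ n → Set
ConsecutiveOnes v =
  ∀ a b c → a < b → b < c → v a ≡ 1ℤ → v c ≡ 1ℤ → v b ≢ 0ℤ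

-- Meaningful only for binary arrays; use together with Φ.
Convex : ∀ {m n} → Array m n → Set
Convex A =
  (∀ i → ConsecutiveOnes (A i)) × (∀ j → ConsecutiveOnes (transpose A j))

-- The sign of 0ℤ in the library is +, hence the explicit nonzero hypotheses.
AlternatingSigns : ∀ {n} → Vector ℤ n → Set
AlternatingSigns v =
  ∀ a c → a < c → v a ≢ 0ℤ → v c ≢ 0ℤ →
  (∀ b → a < b → b < c → v b ≡ 0ℤ) →
  sign (v c) ≡ opposite (sign (v a))

Alternating : ∀ {m n} → Array m n → Set
Alternating A =
  (∀ i → AlternatingSigns (A i)) × (∀ j → AlternatingSigns (transpose A j))

NASM : ∀ m n → Vector ℕ m → Vector ℕ n → Array m n → Set
NASM m n h k A = Ψ m n h k A × Alternating A

{-# OPTIONS --safe #-}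
-- Put a checkerboard of signs on A: multiply the entry in position (i, j) by
-- (-1)^(i+j). Weights do not change. By convexity, consecutive nonzero entries
-- of a line occupy adjacent positions, where the checkerboard signs differ.
module Submission where

open import Defs
open import Data.Empty using (⊥-elim)
open import Data.Fin using (Fin; zero; suc; toℕ; fromℕ<)
open import Data.Fin.Properties using (toℕ-fromℕ<; toℕ<n)
open import Data.Integer using (ℤ; +_; -[1+_]; 0ℤ; 1ℤ; -1ℤ; -_; sign; _≟_)
open import Data.Integer.Properties using (neg-injective)
open import Data.Nat using (ℕ; NonZero; _+_)
open import Data.Nat.Properties using (+-comm; +-suc; m≤n⇒m<n∨m≡n; <-trans; n<1+n)
import Data.Nat as ℕ
open import Data.Product using (∃; _×_; _,_)
open import Data.Sign using (opposite)
open import Data.Sum using (_⊎_; inj₁; inj₂)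
open import Data.Vec.Functional using (Vector; transpose)
open import Function using (_∘_)
open import Relation.Binary.PropositionalEquality
  using (_≡_; _≢_; refl; sym; trans; cong; cong₂; subst; subst₂; module ≡-Reasoning)
open import Relation.Nullary using (yes; no)

-- Stands for multiplication by (-1)^p. Iterating negation makes raising the exponent by one a
-- single negation by computation, which is all that the sign argument uses.
negate^ : ℕ → ℤ → ℤ
negate^ ℕ.zero    x = x
negate^ (ℕ.suc p) x = - negate^ p x

≡0⇒negate^≡0 : ∀ p {x} → x ≡ 0ℤ → negate^ p x ≡ 0ℤ
≡0⇒negate^≡0 ℕ.zero    eq = eq
≡0⇒negate^≡0 (ℕ.suc p) eq = cong -_ (≡0⇒negate^≡0 p eq)

negate^≡0⇒≡0 : ∀ p {x} → negate^ p x ≡ 0ℤ → x ≡ 0ℤ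
negate^≡0⇒≡0 ℕ.zero    eq = eq
negate^≡0⇒≡0 (ℕ.suc p) eq = negate^≡0⇒≡0 p (neg-injective eq)

negate^-ternary : ∀ p {x} → x ≡ 0ℤ ⊎ x ≡ 1ℤ →
  negate^ p x ≡ 0ℤ ⊎ negate^ p x ≡ 1ℤ ⊎ negate^ p x ≡ -1ℤ
negate^-ternary ℕ.zero    (inj₁ eq) = inj₁ eq
negate^-ternary ℕ.zero    (inj₂ eq) = inj₂ (inj₁ eq)
negate^-ternary (ℕ.suc p) x∈01 with negate^-ternary p x∈01
... | inj₁ eq        = inj₁ (cong -_ eq)
... | inj₂ (inj₁ eq) = inj₂ (inj₂ (cong -_ eq))
... | inj₂ (inj₂ eq) = inj₂ (inj₁ (cong -_ eq))

-- Zero must be excluded: it is its own negation, and its sign is `+` by convention.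
sign-neg : ∀ x → x ≢ 0ℤ → sign (- x) ≡ opposite (sign x)
sign-neg (+ ℕ.zero)  x≢0 = ⊥-elim (x≢0 refl)
sign-neg (+ ℕ.suc _) _   = refl
sign-neg -[1+ _ ]    _   = refl

-- The count only sees where the zeros are, and changing signs leaves them in place.
weight-cong : ∀ {n} (v w : Vector ℤ n) →
  (∀ b → v b ≡ 0ℤ → w b ≡ 0ℤ) → (∀ b → w b ≡ 0ℤ → v b ≡ 0ℤ) →
  weight w ≡ weight v
weight-cong {ℕ.zero}  v w v⇒w w⇒v = refl
weight-cong {ℕ.suc n} v w v⇒w w⇒v
  with v zero ≟ 0ℤ | w zero ≟ 0ℤ
     | weight-cong (v ∘ suc) (w ∘ suc) (v⇒w ∘ suc) (w⇒v ∘ suc)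
... | yes _   | yes _   | eq = eq
... | no _    | no _    | eq = cong ℕ.suc eq
... | yes v≡0 | no w≢0  | _  = ⊥-elim (w≢0 (v⇒w zero v≡0))
... | no v≢0  | yes w≡0 | _  = ⊥-elim (v≢0 (w⇒v zero w≡0))

-- The offset `p` is the index of the line itself, so that parallel lines together form the
-- checkerboard.
alternate : ∀ {n} → ℕ → Vector ℤ n → Vector ℤ n
alternate p v b = negate^ (p + toℕ b) (v b)

weight-alternate : ∀ {n} p (v : Vector ℤ n) → weight (alternate p v) ≡ weight v
weight-alternate p v = weight-cong v (alternate p v)
  (λ b → ≡0⇒negate^≡0 (p + toℕ b))
  (λ b → negate^≡0⇒≡0 (p + toℕ b))

alternate-alternating : ∀ {n} p (v : Vector ℤ n) →
  (∀ b → v b ≡ 0ℤ ⊎ v b ≡ 1ℤ) → ConsecutiveOnes v →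
  AlternatingSigns (alternate p v)
alternate-alternating {n} p v binary consecutive a c a<c wa≢0 wc≢0 gap =
  begin
    sign (negate^ (p + toℕ c) (v c))
      -- Both original entries are 1, and adjacency makes the exponent at `c` one more than at `a`;
      -- the extra negation then appears by computation.
      ≡⟨ cong₂ (λ q x → sign (negate^ q x))
               (trans (cong (λ q → p + q) (sym adjacent)) (+-suc p (toℕ a)))
               (trans (one c wc≢0) (sym (one a wa≢0))) ⟩
    sign (- alternate p v a)
      ≡⟨ sign-neg (alternate p v a) wa≢0 ⟩
    opposite (sign (alternate p v a))
  ∎
  where
  open ≡-Reasoning

  one : ∀ b → alternate p v b ≢ 0ℤ → v b ≡ 1ℤ
  one b wb≢0 with binary b
  ... | inj₂ eq = eq
  ... | inj₁ eq = ⊥-elim (wb≢0 (≡0⇒negate^≡0 (p + toℕ b) eq))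

  adjacent : ℕ.suc (toℕ a) ≡ toℕ c
  adjacent with m≤n⇒m<n∨m≡n a<c
  ... | inj₂ eq    = eq
  -- If `c` is not right after `a`, the position right after `a` lies strictly between two ones:
  -- `gap` makes its entry zero, which convexity forbids.
  ... | inj₁ 1+a<c = ⊥-elim
        (consecutive a b c a<b b<c (one a wa≢0) (one c wc≢0)
          (negate^≡0⇒≡0 (p + toℕ b) (gap b a<b b<c)))
    where
    1+a<n : ℕ.suc (toℕ a) ℕ.< n
    1+a<n = <-trans 1+a<c (toℕ<n c)

    b : Fin n
    b = fromℕ< 1+a<n

    a<b : toℕ a ℕ.< toℕ b
    a<b = subst (toℕ a ℕ.<_) (sym (toℕ-fromℕ< 1+a<n)) (n<1+n (toℕ a))

    b<c : toℕ b ℕ.< toℕ c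
    b<c = subst (ℕ._< toℕ c) (sym (toℕ-fromℕ< 1+a<n)) 1+a<c

theorem2p7 : (m n : ℕ) → .{{_ : NonZero m}} → .{{_ : NonZero n}} →
    (h : Vector ℕ m) → (k : Vector ℕ n) →
    (∃ λ (A : Array m n) → Φ m n h k A × Convex A) →
    ∃ λ (B : Array m n) → NASM m n h k B
theorem2p7 m n h k (A , (binary , rowWeight , colWeight) , rowConvex , colConvex) =
  B
  , ( (λ i j → negate^-ternary (toℕ i + toℕ j) (binary i j))
    , (λ i → trans (weight-alternate (toℕ i) (A i)) (rowWeight i))
    -- `B` is built by rows, so its columns are not literally of the form `alternate`; comparing
    -- zeros directly avoids the mismatch.
    , (λ j → trans (weight-cong (transpose A j) (transpose B j)
                      (λ i → ≡0⇒negate^≡0 (toℕ i + toℕ j))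
                      (λ i → negate^≡0⇒≡0 (toℕ i + toℕ j)))
                   (colWeight j)))
  , (λ i → alternate-alternating (toℕ i) (A i) (binary i) (rowConvex i))
  , colAlternating
  where
  B : Array m n
  B i = alternate (toℕ i) (A i)

  -- The checkerboard is symmetric in rows and columns; this carries the result on single lines over
  -- to the columns.
  column : ∀ j i → alternate (toℕ j) (transpose A j) i ≡ B i j
  column j i = cong (λ q → negate^ q (A i j)) (+-comm (toℕ j) (toℕ i))

  colAlternating : ∀ j → AlternatingSigns (transpose B j)
  colAlternating j a c a<c Ba≢0 Bc≢0 gap =
    subst₂ (λ x y → sign y ≡ opposite (sign x)) (column j a) (column j c)
      (alternate-alternating (toℕ j) (transpose A j) (λ i → binary i j) (colConvex j)
        a c a<c (Ba≢0 ∘ trans (sym (column j a))) (Bc≢0 ∘ trans (sym (column j c)))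
        (λ b a<b b<c → trans (column j b) (gap b a<b b<c)))
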